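{- Let $G$ be a signed ribbon graph, let $E'\subseteq E(G)$ be any subset of its edges, and let $G':=G^{E'}$ be the dual of $G$ with respect to $E'$. Then the restriction of the polynomial $x^{k(G)}y^{v(G)}z^{v(G)+1}R_G(x,y,z)$ to the surface $xyz^2=1$ is invariant under this generalized duality, i.e. $$x^{k(G)} y^{v(G)} z^{v(G)+1} R_G(x,y,z)\Big|_{xyz^2=1} = x^{k(G')} y^{v(G')} z^{v(G')+1} R_{G'}(x,y,z)\Big|_{xyz^2=1},$$ where $R$ denotes the signed Bollobás–Riordan polynomial. (If half-integer exponents occur, restriction to $xyz^2=1$ is understood as restriction to $x^{1/2}y^{1/2}z=1$.)
   Context: **Ribbon graphs.** A ribbon graph $G$ is a (possibly non-orientable) surface with boundary, represented as the union of two finite sets of closed topological discs, vertices $V(G)$ and edges $E(G)$, such that: vertices and edges intersect in disjoint line segments; each such segment lies on the boundary of precisely one vertex and precisely one edge; every edge contains exactly two such segments. Ribbon graphs are considered up to homeomorphism preserving the decomposition into vertices and edges. $G$ is signed if it comes with a sign function $\varepsilon: E(G)\to\{\pm1\}$ (homeomorphisms preserve signs). **Arrow presentation.** Equivalently, a ribbon graph is a collection of disjoint oriented circles (one per vertex) carrying labeled arrows, each label occurring exactly twice, modulo: reversing all arrows on a circle together with the cyclic order of arrows along it; reversing both arrows with the same label. To recover the surface, fill each circle with a vertex-disc and, for each label $e$, attach a rectangle (the edge $e$) along a pair of opposite sides to the two arrows labeled $e$, so that both arrows are coherent with one orientation of the boundary of the rectangle. **Generalized dual.** For $E'\subseteq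 E(G)$ the signed ribbon graph $G^{E'}$ is defined as follows. Let $F_{E'}$ be the spanning subgraph of $G$ with all vertices of $G$ and only the edges of $E'$. The circles (vertices) of $G^{E'}$ are the boundary components of the surface $F_{E'}$. The edges of $G^{E'}$ are the same discs as those of $G$: an edge $e\notin E'$ gives the same pair of arrows as in $G$ (these lie on the boundary of $F_{E'}$); an edge $e\in E'$, viewed as a rectangle attached in $G$ to vertex-discs by two opposite sides, now gives the arrows on its other pair of opposite sides (which lie on the boundary of $F_{E'}$), directed by an orientation of the boundary of the rectangle. In particular $E(G^{E'})$ is identified with $E(G)$. Signs: $\varepsilon_{G^{E'}}(e)=-\varepsilon_G(e)$ for $e\in E'$ and $\varepsilon_{G^{E'}}(e)=\varepsilon_G(e)$ for $e\notin E'$. **Parameters.** $v(G)=|V(G)|$, $e(G)=|E(G)|$, $k(G)$ is the number of connected components, $r(G)=v(G)-k(G)$, $n(G)=e(G)-r(G)$, and $f(G)$ is the number of connected components of the boundary of the surface $G$. $\mathcal F(G)$ is the set of spanning subgraphs of $G$ (all vertices of $G$ and a subset of the edges). For $F\in\mathcal F(G)$, $\overline F$ is the spanning subgraph with exactly the edges of $G$ not in $F$, $e_-(F)$ is the number of negative edges of $F$, and $s(F)=\frac{e_-(F)-e_-(\overline F)}{2}$. **Signed Bollobás–Riordan polynomial.** $$R_G(x,y,z):=\sum_{F\in\mathcal F(G)} x^{r(G)-r(F)+s(F)}\,y^{n(F)-s(F)}\,z^{k(F)-f(F)+n(F)},$$ a Laurent polynomial in $x^{1/2},y^{1/2},z$.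 -}

module Defs where

open import Algebra.Bundles using (CommutativeRing)
open import Algebra.Definitions using (Invertible)
open import Data.Bool.Base using (Bool; true; false; not; if_then_else_)
import Data.Bool.Properties as Bool
open import Data.Fin.Base using (Fin)
import Data.Fin.Properties as Fin
open import Data.Fin.Subset using (Subset; inside; outside; ⊤; ∁; _∩_; ∣_∣)
open import Data.Integer.Base as ℤ using (ℤ; +_; -[1+_])
open import Data.List.Base as List using (List; []; _∷_; _++_)
open import Data.List.Membership.Propositional using (_∈_)
open import Data.List.Relation.Unary.Any using (here; there)
open import Data.Nat.Base as ℕ using (ℕ; zero; suc)
open import Data.Product.Base using (∃; _×_; _,_; proj₁)
import Data.Product.Properties as Product
open import Data.Sign.Base as Sign using (Sign)
import Data.Sign.Properties as Sign
open import Data.Vec.Base as Vec using (Vec; lookup)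
open import Function.Base using (id)
open import Function.Bundles using (_⇔_; mk⇔)
open import Level using (_⊔_)
open import Relation.Binary.Construct.Closure.Equivalence as EqC using (EqClosure)
import Relation.Binary.Construct.Closure.ReflexiveTransitive as Star
open import Relation.Binary.Construct.Closure.ReflexiveTransitive using (ε; _◅_)
open import Relation.Binary.Construct.Closure.Symmetric using (fwd; bwd)
open import Relation.Binary.Definitions using (DecidableEquality)
open import Relation.Binary.PropositionalEquality
  using (_≡_; _≢_; refl; sym; trans; cong)
open import Relation.Nullary using (yes; no; does; contradiction)

------------------------------------------------------------------------
-- Connected components of a finite graph

-- Every point gets a label, at first itself; each link (a , b) in turn
-- replaces the label of b by that of a wherever it occurs.  By
-- `sameLabel⇔` below, two points end up with the same label iff they are
-- connected by links, so the number of distinct labels is the number of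
-- components.

module Components {A : Set} (_≟_ : DecidableEquality A) where

  merge : A × A → (A → A) → A → A
  merge (a , b) ℓ x with ℓ x ≟ ℓ b
  ... | yes _ = ℓ a
  ... | no  _ = ℓ x

  label : List (A × A) → A → A
  label = List.foldr merge id

  components : List A → List (A × A) → ℕ
  components points links =
    List.length (List.deduplicate _≟_ (List.map (label links) points))

  Connected : List (A × A) → A → A → Set
  Connected links = EqClosure (λ x y → (x , y) ∈ links)

  private
    weaken : ∀ {l ls x y} → Connected ls x y → Connected (l ∷ ls) x y
    weaken = EqC.map there

    sound : ∀ links {x y} → label links x ≡ label links y → Connected links x y
    sound [] refl = ε
    sound ((a , b) ∷ ls) {x} {y} eq
      with label ls x ≟ label ls b | label ls y ≟ label ls b
    ... | yes p | yes q = weaken (sound ls (trans p (sym q)))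
    ... | yes p | no  _ = weaken (sound ls p) Star.◅◅
                          bwd (here refl) ◅ weaken (sound ls eq)
    ... | no  _ | yes q = weaken (sound ls eq) Star.◅◅
                          fwd (here refl) ◅ weaken (sound ls (sym q))
    ... | no  _ | no  _ = weaken (sound ls eq)

    linked : ∀ links {x y} → (x , y) ∈ links → label links x ≡ label links y
    linked ((a , b) ∷ ls) (here refl)
      with label ls a ≟ label ls b | label ls b ≟ label ls b
    ... | yes _ | yes _ = refl
    ... | no  _ | yes _ = refl
    ... | _     | no ¬p = contradiction refl ¬p
    linked ((a , b) ∷ ls) {x} {y} (there m)
      with label ls x ≟ label ls b | label ls y ≟ label ls b
    ... | yes _ | yes _ = refl
    ... | yes p | no ¬q = contradiction (trans (sym (linked ls m)) p) ¬q
    ... | no ¬p | yes q = contradiction (trans (linked ls m) q) ¬p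
    ... | no  _ | no  _ = linked ls m

    complete : ∀ links {x y} → Connected links x y → label links x ≡ label links y
    complete links ε           = refl
    complete links (fwd m ◅ p) = trans (linked links m) (complete links p)
    complete links (bwd m ◅ p) = trans (sym (linked links m)) (complete links p)

  sameLabel⇔ : ∀ links {x y} →
               (label links x ≡ label links y) ⇔ Connected links x y
  sameLabel⇔ links = mk⇔ (sound links) (complete links)

------------------------------------------------------------------------
-- Ribbon graphs

-- The edge e is the rectangle [0,1]², with corners (e , i , j).  It is
-- attached to the vertex-discs along its two sides i = 0 and i = 1; the
-- sides j = 0 and j = 1 are free.  In terms of arrows, the two arrows
-- labelled e go from (0,0) to (0,1) and from (1,1) to (1,0), coherently
-- with one orientation of the boundary of the rectangle.

Corner : ℕ → Set
Corner n = Fin n × Bool × Bool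

edgeOf : ∀ {n} → Corner n → Fin n
edgeOf = proj₁

_≟ᶜ_ : ∀ {n} → DecidableEquality (Corner n)
_≟ᶜ_ = Product.≡-dec Fin._≟_ (Product.≡-dec Bool._≟_ Bool._≟_)

bools : List Bool
bools = false ∷ true ∷ []

corners : ∀ n → List (Corner n)
corners n = List.cartesianProduct (List.allFin n)
              (List.cartesianProduct bools bools)

-- The other end of the attached, respectively free, side at a corner.

attachedMate freeMate : ∀ {n} → Corner n → Corner n
attachedMate (e , i , j) = e , i , not j
freeMate     (e , i , j) = e , not i , j

-- A signed ribbon graph as an arrow presentation.  The arrows cut the
-- circles that carry arrows into arcs, each joining two corners; `arc`
-- sends a corner to the other end of its arc.  The circles themselves are
-- the closed curves formed by the arcs and the attached sides, so they
-- carry no preferred orientation.  Circles without arrows (vertex-discs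
-- meeting no edge) are only counted, by `isolated`.

record SignedRibbonGraph : Set where
  field
    edges          : ℕ
    isolated       : ℕ
    arc            : Corner edges → Corner edges
    arc-involutive : ∀ c → arc (arc c) ≡ c
    arc-fixfree    : ∀ c → arc c ≢ c
    sign           : Fin edges → Sign

open SignedRibbonGraph public

-- A spanning subgraph of G is given by its set of edges.

SpanningSubgraph : SignedRibbonGraph → Set
SpanningSubgraph G = Subset (edges G)

module _ (G : SignedRibbonGraph) where

  open Components (_≟ᶜ_ {edges G})

  linksOf : (Corner (edges G) → Corner (edges G)) →
            List (Corner (edges G) × Corner (edges G))
  linksOf mate = List.map (λ c → c , mate c) (corners (edges G))

  classes : List (Corner (edges G) × Corner (edges G)) → ℕ
  classes = components (corners (edges G))

  v : ℕ
  v = isolated G ℕ.+ classes (linksOf (arc G) ++ linksOf attachedMate)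

  -- The boundary of the surface F runs along the free sides of the edges in
  -- F and, where an edge outside F has been removed, along its attached
  -- sides.

  boundaryMate : SpanningSubgraph G → Corner (edges G) → Corner (edges G)
  boundaryMate F c = if lookup F (edgeOf c) then freeMate c else attachedMate c

  f : SpanningSubgraph G → ℕ
  f F = isolated G ℕ.+ classes (linksOf (arc G) ++ linksOf (boundaryMate F))

  -- Vertex-discs are connected by arcs and attached sides, and the two ends
  -- of an edge of F by its free sides.

  edgeMate : SpanningSubgraph G → Corner (edges G) → Corner (edges G)
  edgeMate F c = if lookup F (edgeOf c) then freeMate c else c

  k : SpanningSubgraph G → ℕ
  k F = isolated G ℕ.+
        classes (linksOf (arc G) ++ linksOf attachedMate ++ linksOf (edgeMate F))

  r : SpanningSubgraph G → ℤ
  r F = + v ℤ.- + k F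

  n : SpanningSubgraph G → ℤ
  n F = + ∣ F ∣ ℤ.- r F

  negativeEdges : Subset (edges G)
  negativeEdges = Vec.tabulate (λ e → does (sign G e Sign.≟ Sign.-))

  e₋ : SpanningSubgraph G → ℕ
  e₋ F = ∣ F ∩ negativeEdges ∣

  -- 2 s(F)

  2s : SpanningSubgraph G → ℤ
  2s F = + e₋ F ℤ.- + e₋ (∁ F)

------------------------------------------------------------------------
-- Generalized duality

-- For e ∈ E′ the attached and the free sides of the rectangle e exchange
-- their roles, i.e. its two coordinates are swapped.

swap : ∀ {n} → Subset n → Corner n → Corner n
swap E′ (e , i , j) = e , (if lookup E′ e then (j , i) else (i , j))

swap-involutive : ∀ {n} (E′ : Subset n) c → swap E′ (swap E′ c) ≡ c
swap-involutive E′ (e , i , j) with lookup E′ e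
... | true  = refl
... | false = refl

dual : (G : SignedRibbonGraph) → Subset (edges G) → SignedRibbonGraph
dual G E′ = record
  { edges          = edges G
  ; isolated       = isolated G
  ; arc            = λ c → swap E′ (arc G (swap E′ c))
  ; arc-involutive = λ c →
      trans (cong (λ d → swap E′ (arc G d)) (swap-involutive E′ _))
      (trans (cong (swap E′) (arc-involutive G _)) (swap-involutive E′ c))
  ; arc-fixfree    = λ c eq → arc-fixfree G (swap E′ c)
      (trans (sym (swap-involutive E′ _)) (cong (swap E′) eq))
  ; sign           = λ e →
      if lookup E′ e then Sign.opposite (sign G e) else sign G e
  }

-- The circles of the dual are the boundary components of the spanning
-- subgraph with edge set E′: up to the renaming `swap E′` of the corners,
-- both are formed by the arcs of G and the sides below.

dual-circles : ∀ (G : SignedRibbonGraph) (E′ : Subset (edges G)) c →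
               attachedMate (swap E′ c) ≡ swap E′ (boundaryMate G E′ c)
dual-circles G E′ (e , i , j) with lookup E′ e in eq
... | true  rewrite eq = refl
... | false rewrite eq = refl

------------------------------------------------------------------------
-- Laurent polynomials in three variables

-- A monomial is its triple of exponents; a list of monomials stands for
-- their sum.

Monomial : Set
Monomial = ℤ × ℤ × ℤ

Laurent : Set
Laurent = List Monomial

infixl 7 _⊗_
_⊗_ : Monomial → Monomial → Monomial
(a , b , c) ⊗ (i , j , l) = a ℤ.+ i , b ℤ.+ j , c ℤ.+ l

infixr 7 _·_
_·_ : Monomial → Laurent → Laurent
m · P = List.map (m ⊗_) P

-- inRoots P is P(x , y , z) as a Laurent polynomial in x^{1/2}, y^{1/2}, z.

doubleXY : Monomial → Monomial
doubleXY (i , j , l) = + 2 ℤ.* i , + 2 ℤ.* j , l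

inRoots : Laurent → Laurent
inRoots = List.map doubleXY

module Evaluation {c ℓ} (K : CommutativeRing c ℓ) where

  open CommutativeRing K
  open import Algebra.Properties.Semiring.Exp semiring using (_^_)

  Unit : Set (c ⊔ ℓ)
  Unit = ∃ (Invertible _≈_ 1# _*_)

  ⟦_⟧ : Unit → Carrier
  ⟦_⟧ = proj₁

  infixr 8 _^ℤ_
  _^ℤ_ : Unit → ℤ → Carrier
  (u , _)       ^ℤ (+ m)    = u ^ m
  (_ , u⁻¹ , _) ^ℤ -[1+ m ] = u⁻¹ ^ suc m

  evalMonomial : Monomial → Unit → Unit → Unit → Carrier
  evalMonomial (i , j , l) x y z = x ^ℤ i * y ^ℤ j * z ^ℤ l

  eval : Laurent → Unit → Unit → Unit → Carrier
  eval P x y z = List.foldr (λ m s → evalMonomial m x y z + s) 0# P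

  -- Equality of Laurent polynomials in x^{1/2}, y^{1/2}, z restricted to
  -- x^{1/2} y^{1/2} z = 1.

  EqualOn-√x√yz≈1 : Laurent → Laurent → Set (c ⊔ ℓ)
  EqualOn-√x√yz≈1 P Q = ∀ √x √y z → ⟦ √x ⟧ * ⟦ √y ⟧ * ⟦ z ⟧ ≈ 1# →
                        eval P √x √y z ≈ eval Q √x √y z

  -- Equality of Laurent polynomials in x, y, z restricted to x y z² = 1.

  EqualOn-xyz²≈1 : Laurent → Laurent → Set (c ⊔ ℓ)
  EqualOn-xyz²≈1 P Q = ∀ x y z → ⟦ x ⟧ * ⟦ y ⟧ * ⟦ z ⟧ ^ 2 ≈ 1# →
                       eval P x y z ≈ eval Q x y z

------------------------------------------------------------------------
-- The signed Bollobás–Riordan polynomial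

subsets : ∀ m → List (Subset m)
subsets zero    = Vec.[] ∷ []
subsets (suc m) = List.map (outside Vec.∷_) (subsets m) ++
                  List.map (inside  Vec.∷_) (subsets m)

spanningSubgraphs : (G : SignedRibbonGraph) → List (SpanningSubgraph G)
spanningSubgraphs G = subsets (edges G)

-- R_G as a Laurent polynomial in x^{1/2}, y^{1/2}, z; hence the exponents
-- of the first two variables are doubled.

term : (G : SignedRibbonGraph) → SpanningSubgraph G → Monomial
term G F = + 2 ℤ.* (r G ⊤ ℤ.- r G F) ℤ.+ 2s G F
         , + 2 ℤ.* n G F ℤ.- 2s G F
         , + k G F ℤ.- + f G F ℤ.+ n G F

R : SignedRibbonGraph → Laurent
R G = List.map (term G) (spanningSubgraphs G)

-- x^{k(G)} y^{v(G)} z^{v(G)+1} R_G(x , y , z), likewise in x^{1/2}, y^{1/2}, z.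

normalizedR : SignedRibbonGraph → Laurent
normalizedR G = (+ 2 ℤ.* + k G ⊤ , + 2 ℤ.* + v G , + suc (v G)) · R G

{-# OPTIONS --safe #-}

-- Put N(F) = |F Δ negativeEdges|.  Including the prefactor, the exponents
-- (a , b , l) of x^{1/2}, y^{1/2}, z in the term of F satisfy b = a + 2 N(F)
-- and l = a + N(F) + 1 - f(F), so on x^{1/2} y^{1/2} z = 1 the term depends
-- on N(F) and f(F) alone.  The bijection F ↦ F Δ E′ from the spanning
-- subgraphs of G to those of the dual preserves N, since the negative edges
-- also change by Δ E′, and it preserves f, since `swap E′` carries the
-- boundary curves of F to those of F Δ E′.

module Submission where

open import Defs
open import Algebra.Bundles using (CommutativeRing)
open import Data.Bool.Base using (true; false; if_then_else_; _xor_)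
open import Data.Fin.Subset using (Subset; ⊤; ∁; _∩_; ∣_∣)
open import Data.Integer.Base as ℤ using (ℤ; +_; -[1+_])
import Data.Integer.Properties as ℤ
import Data.Integer.Tactic.RingSolver as ℤ-Solver
open import Data.List.Base using (List; []; _∷_; _++_; map; foldr; length; deduplicate)
open import Data.List.Membership.Propositional using (_∈_)
open import Data.List.Membership.Propositional.Properties
open import Data.List.Properties using (map-id; map-∘; map-++; map-cong; ∷-injective)
open import Data.List.Relation.Binary.Permutation.Propositional
  using (_↭_; ↭-refl; ↭-trans; ↭-reflexive; ↭⇒↭ₛ′)
open import Data.List.Relation.Binary.Permutation.Propositional.Properties
  using (∈-resp-↭; ↭-length; shift; map⁺; ++⁺; ++-comm)
import Data.List.Relation.Binary.Permutation.Setoid.Properties as Permutationₛ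
import Data.List.Relation.Unary.All as All
import Data.List.Relation.Unary.AllPairs as AllPairs
open import Data.List.Relation.Unary.Any using (here; there)
open import Data.List.Relation.Unary.Unique.Propositional using (Unique)
import Data.List.Relation.Unary.Unique.DecPropositional.Properties as Unique
open import Data.Nat.Base as ℕ using (ℕ; zero; suc; _≤_; z≤n; s≤s)
import Data.Nat.Properties as ℕ
open import Data.Product.Base using (∃; _×_; _,_)
import Data.Sign.Base as Sign
import Data.Sign.Properties as Sign
open import Data.Sum.Base using (inj₁; inj₂)
open import Data.Vec.Base as Vec using (lookup; zipWith)
import Data.Vec.Properties as Vec
open import Function.Base using (id; _∘_)
open import Function.Bundles using (Equivalence)
import Relation.Binary.Construct.Closure.Equivalence as EqC
open import Relation.Binary.Definitions using (DecidableEquality)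
open import Relation.Binary.PropositionalEquality
  using (_≡_; refl; sym; trans; cong; cong₂; subst; module ≡-Reasoning)
open import Relation.Nullary using (does; contradiction)

-- Counting connected components

-- Pigeonhole by induction on `as`: the partner `b` of the head is removed from `bs`, and by
-- injectivity no later element can need it. A relation stands in for an injective function, because
-- between sets of labels a partner arises only from a choice of point.
length-≤-via : ∀ {A B : Set} (R : A → B → Set) →
               (∀ {a a′ b} → R a b → R a′ b → a ≡ a′) →
               ∀ {as bs} → Unique as →
               (∀ {a} → a ∈ as → ∃ λ b → b ∈ bs × R a b) →
               length as ≤ length bs
length-≤-via R inj {[]} _ _ = z≤n
length-≤-via R inj {a ∷ as} {bs} (a∉as AllPairs.∷ uniq) total
  with b , b∈bs , Rab ← total (here refl)
  with ys , zs , refl ← ∈-∃++ b∈bs =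
  subst (suc (length as) ≤_) (sym (↭-length (shift b ys zs)))
    (s≤s (length-≤-via R inj uniq total′))
  where
  total′ : ∀ {a′} → a′ ∈ as → ∃ λ b′ → b′ ∈ ys ++ zs × R a′ b′
  total′ a′∈as with b′ , b′∈bs , Ra′b′ ← total (there a′∈as)
    with ∈-resp-↭ (shift b ys zs) b′∈bs
  ... | here refl = contradiction (inj Rab Ra′b′) (All.lookup a∉as a′∈as)
  ... | there b′∈ = b′ , b′∈ , Ra′b′

module _ {A : Set} (_≟_ : DecidableEquality A) where

  open Components _≟_

  -- Labels are arbitrary representatives, which `σ` need not respect. So a label for `links` is
  -- paired with the label for `links′` of the image of any point bearing it. The pairing is
  -- injective because `σ⁻¹` takes a chain of links between images back to a chain between the
  -- points.
  components-≤ : ∀ (σ σ⁻¹ : A → A) → (∀ x → σ⁻¹ (σ x) ≡ x) →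
                 ∀ {points links links′} → (∀ x → x ∈ points) →
                 (∀ {x y} → (x , y) ∈ links → (σ x , σ y) ∈ links′) →
                 (∀ {x y} → (x , y) ∈ links′ → (σ⁻¹ x , σ⁻¹ y) ∈ links) →
                 components points links ≤ components points links′
  components-≤ σ σ⁻¹ σ⁻¹σ {points} {links} {links′} full to from =
    length-≤-via Related injective (Unique.deduplicate-! _≟_ (map (label links) points)) total
    where
    Related : A → A → Set
    Related a b = ∃ λ x → a ≡ label links x × b ≡ label links′ (σ x)

    reflects : ∀ {x y} → label links′ (σ x) ≡ label links′ (σ y) →
               label links x ≡ label links y
    reflects {x} {y} eq = subst (λ u → label links u ≡ label links y) (σ⁻¹σ x)
      (subst (λ u → label links (σ⁻¹ (σ x)) ≡ label links u) (σ⁻¹σ y)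
        (Equivalence.from (sameLabel⇔ links)
          (EqC.gmap σ⁻¹ from (Equivalence.to (sameLabel⇔ links′) eq))))

    injective : ∀ {a a′ b} → Related a b → Related a′ b → a ≡ a′
    injective (_ , p , q) (_ , p′ , q′) =
      trans p (trans (reflects (trans (sym q) q′)) (sym p′))

    total : ∀ {a} → a ∈ deduplicate _≟_ (map (label links) points) →
            ∃ λ b → b ∈ deduplicate _≟_ (map (label links′) points) × Related a b
    total a∈ with x , _ , a≡ ← ∈-map⁻ (label links)
        (∈-deduplicate⁻ _≟_ (map (label links) points) a∈) =
      label links′ (σ x) ,
      ∈-deduplicate⁺ _≟_ (∈-map⁺ (label links′) (full (σ x))) , x , a≡ , refl

∈-corners : ∀ {n} (c : Corner n) → c ∈ corners n
∈-corners (e , i , j) =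
  ∈-cartesianProduct⁺ (∈-allFin e) (∈-cartesianProduct⁺ (∈-bools i) (∈-bools j))
  where
  ∈-bools : ∀ b → b ∈ bools
  ∈-bools false = here refl
  ∈-bools true  = there (here refl)

-- Symmetric differences

infixl 6 _Δ_
_Δ_ : ∀ {n} → Subset n → Subset n → Subset n
_Δ_ = zipWith _xor_

-- The first bit of `E` decides whether the two halves of `subsets (suc m)` stay in place or are
-- exchanged; within each half the induction hypothesis applies.
subsets-Δ : ∀ {m} (E : Subset m) → map (_Δ E) (subsets m) ↭ subsets m
subsets-Δ Vec.[] = ↭-refl
subsets-Δ {suc m} (b Vec.∷ E) = ↭-trans (↭-reflexive (map-++ _ (map (false Vec.∷_) S) _))
  (↭-trans (++⁺ (extend false) (extend true)) (reorder b))
  where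
  S = subsets m
  extend : ∀ a → map (_Δ (b Vec.∷ E)) (map (a Vec.∷_) S) ↭ map ((a xor b) Vec.∷_) S
  -- The fused map prepends `a xor b` to the translate by `E`, so it splits again with the
  -- translation innermost.
  extend a = ↭-trans (↭-reflexive (trans (sym (map-∘ S)) (map-∘ S)))
                     (map⁺ _ (subsets-Δ E))
  reorder : ∀ b → map ((false xor b) Vec.∷_) S ++ map ((true xor b) Vec.∷_) S ↭ subsets (suc m)
  reorder false = ↭-refl
  reorder true  = ++-comm (map (true Vec.∷_) S) _

lookup-ext : ∀ {A : Set} {n} {xs ys : Vec.Vec A n} →
             (∀ i → lookup xs i ≡ lookup ys i) → xs ≡ ys
lookup-ext eq = trans (sym (Vec.tabulate∘lookup _))
                      (trans (Vec.tabulate-cong eq) (Vec.tabulate∘lookup _))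

-- With `q` the negative edges, the two intersections are counted by `e₋` of a subgraph and of its
-- complement, whose difference is `2s`.
∣Δ∣ : ∀ {n} (p q : Subset n) →
      ∣ p Δ q ∣ ℕ.+ ∣ p ∩ q ∣ ≡ ∣ p ∣ ℕ.+ ∣ ∁ p ∩ q ∣
∣Δ∣ Vec.[] Vec.[] = refl
∣Δ∣ (true  Vec.∷ p) (true  Vec.∷ q) = trans (ℕ.+-suc _ _) (cong suc (∣Δ∣ p q))
∣Δ∣ (true  Vec.∷ p) (false Vec.∷ q) = cong suc (∣Δ∣ p q)
∣Δ∣ (false Vec.∷ p) (true  Vec.∷ q) = trans (cong suc (∣Δ∣ p q)) (sym (ℕ.+-suc _ _))
∣Δ∣ (false Vec.∷ p) (false Vec.∷ q) = ∣Δ∣ p q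

-- Invariants of F ↦ F Δ E′

-- On an edge of `E′` the coordinates are swapped and membership in the subgraph is toggled: free
-- and attached sides are exchanged twice. On other edges nothing changes.
swap-boundaryMate : ∀ G (E′ F : Subset (edges G)) c →
  swap E′ (boundaryMate G F c) ≡
  boundaryMate (dual G E′) (F Δ E′) (swap E′ c)
swap-boundaryMate G E′ F (e , i , j)
  rewrite Vec.lookup-zipWith _xor_ e F E′
  with lookup F e | lookup E′ e in eq
... | true  | true  rewrite eq = refl
... | true  | false rewrite eq = refl
... | false | true  rewrite eq = refl
... | false | false rewrite eq = refl

f-dual : ∀ G (E′ F : Subset (edges G)) → f G F ≡ f (dual G E′) (F Δ E′)
f-dual G E′ F = cong (isolated G ℕ.+_) (ℕ.≤-antisym
  (components-≤ _≟ᶜ_ σ σ (swap-involutive E′) ∈-corners to from)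
  (components-≤ _≟ᶜ_ σ σ (swap-involutive E′) ∈-corners from to))
  where
  G′ = dual G E′
  σ = swap E′

  links  = linksOf G (arc G) ++ linksOf G (boundaryMate G F)
  links′ = linksOf G′ (arc G′) ++ linksOf G′ (boundaryMate G′ (F Δ E′))

  ∈-linksOf : ∀ (mate : Corner (edges G) → Corner (edges G)) {x y} →
              y ≡ mate x → (x , y) ∈ linksOf G mate
  ∈-linksOf mate refl = ∈-map⁺ _ (∈-corners _)

  to : ∀ {x y} → (x , y) ∈ links → (σ x , σ y) ∈ links′
  to xy∈ with ∈-++⁻ (linksOf G (arc G)) xy∈
  ... | inj₁ m with c , _ , refl ← ∈-map⁻ _ m =
    ∈-++⁺ˡ (∈-linksOf _ (cong (σ ∘ arc G) (sym (swap-involutive E′ c))))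
  ... | inj₂ m with c , _ , refl ← ∈-map⁻ _ m =
    ∈-++⁺ʳ (linksOf G′ (arc G′)) (∈-linksOf _ (swap-boundaryMate G E′ F c))

  from : ∀ {x y} → (x , y) ∈ links′ → (σ x , σ y) ∈ links
  from xy∈ with ∈-++⁻ (linksOf G′ (arc G′)) xy∈
  ... | inj₁ m with c , _ , refl ← ∈-map⁻ _ m =
    ∈-++⁺ˡ (∈-linksOf _ (swap-involutive E′ _))
  ... | inj₂ m with c , _ , refl ← ∈-map⁻ _ m =
    -- `swap-boundaryMate` expects an argument of the form `σ _`, so `c` is first written as
    -- `σ (σ c)`.
    ∈-++⁺ʳ (linksOf G (arc G)) (∈-linksOf _ (begin
      σ (boundaryMate G′ (F Δ E′) c)
        ≡⟨ cong (σ ∘ boundaryMate G′ (F Δ E′)) (swap-involutive E′ c) ⟨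
      σ (boundaryMate G′ (F Δ E′) (σ (σ c)))
        ≡⟨ cong σ (swap-boundaryMate G E′ F (σ c)) ⟨
      σ (σ (boundaryMate G F (σ c)))
        ≡⟨ swap-involutive E′ _ ⟩
      boundaryMate G F (σ c) ∎))
    where open ≡-Reasoning

N : ∀ G → SpanningSubgraph G → ℕ
N G F = ∣ F Δ negativeEdges G ∣

N-dual : ∀ G (E′ F : Subset (edges G)) → N G F ≡ N (dual G E′) (F Δ E′)
N-dual G E′ F = cong ∣_∣ {F Δ negativeEdges G} {F Δ E′ Δ negativeEdges (dual G E′)}
  (lookup-ext λ e → begin
  lookup (F Δ negativeEdges G) e
    ≡⟨ Vec.lookup-zipWith _xor_ e F _ ⟩
  lookup F e xor lookup (negativeEdges G) e
    ≡⟨ cong (lookup F e xor_) (Vec.lookup∘tabulate _ e) ⟩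
  lookup F e xor does (sign G e Sign.≟ Sign.-)
    ≡⟨ flip-both (lookup F e) (lookup E′ e) (sign G e) ⟩
  (lookup F e xor lookup E′ e) xor does (sign (dual G E′) e Sign.≟ Sign.-)
    ≡⟨ cong₂ _xor_ (Vec.lookup-zipWith _xor_ e F E′) (Vec.lookup∘tabulate _ e) ⟨
  lookup (F Δ E′) e xor lookup (negativeEdges (dual G E′)) e
    ≡⟨ Vec.lookup-zipWith _xor_ e (F Δ E′) _ ⟨
  lookup (F Δ E′ Δ negativeEdges (dual G E′)) e ∎)
  where
  open ≡-Reasoning
  flip-both : ∀ a b s → a xor does (s Sign.≟ Sign.-) ≡
    (a xor b) xor does ((if b then Sign.opposite s else s) Sign.≟ Sign.-)
  flip-both true  true  Sign.+ = refl
  flip-both true  true  Sign.- = refl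
  flip-both true  false Sign.+ = refl
  flip-both true  false Sign.- = refl
  flip-both false true  Sign.+ = refl
  flip-both false true  Sign.- = refl
  flip-both false false Sign.+ = refl
  flip-both false false Sign.- = refl

-- The exponents of a normalized term

normalizedTerm : ∀ G → SpanningSubgraph G → Monomial
normalizedTerm G F = (+ 2 ℤ.* + k G ⊤ , + 2 ℤ.* + v G , + suc (v G)) ⊗ term G F

normalizedR-map : ∀ G → normalizedR G ≡ map (normalizedTerm G) (spanningSubgraphs G)
normalizedR-map G = sym (map-∘ (spanningSubgraphs G))

-- The exponent of `z` left after that of `x^{1/2}` is split off; the 1 comes from `suc (v G)` in
-- the prefactor.
zExponent : ℕ → ℕ → ℤ
zExponent N f = + N ℤ.+ (+ 1 ℤ.- + f)

size-N : ∀ G F → + ∣ F ∣ ≡ + N G F ℤ.+ 2s G F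
size-N G F = begin
  + ∣ F ∣                                     ≡⟨ cancel (+ ∣ F ∣) (+ e₋ G (∁ F)) ⟩
  + (∣ F ∣ ℕ.+ e₋ G (∁ F)) ℤ.- + e₋ G (∁ F)   ≡⟨ cong (λ t → + t ℤ.- + e₋ G (∁ F)) (∣Δ∣ F (negativeEdges G)) ⟨
  + (N G F ℕ.+ e₋ G F) ℤ.- + e₋ G (∁ F)       ≡⟨ ℤ.+-assoc (+ N G F) (+ e₋ G F) (ℤ.- + e₋ G (∁ F)) ⟩
  + N G F ℤ.+ 2s G F                          ∎
  where
  open ≡-Reasoning
  cancel : ∀ a b → a ≡ (a ℤ.+ b) ℤ.- b
  cancel = ℤ-Solver.solve-∀

-- Once `size-N` has replaced the number of edges, `a` simplifies to `2 k(F) + 2s(F)`, and the same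
-- quantity occurs in `b` and `l`. The triple is given by an equation so that monomials known only
-- after doubling are covered too.
normalizedTerm-exponents : ∀ G F {a b l} → (a , b , l) ≡ normalizedTerm G F →
  b ≡ a ℤ.+ + 2 ℤ.* + N G F × l ≡ a ℤ.+ zExponent (N G F) (f G F)
normalizedTerm-exponents G F refl rewrite size-N G F =
  y-exponent (+ v G) (+ k G ⊤) (+ k G F) (+ N G F) (2s G F) ,
  z-exponent (+ v G) (+ k G ⊤) (+ k G F) (+ N G F) (2s G F) (+ f G F)
  where
  y-exponent : ∀ v k₀ k N s →
    + 2 ℤ.* v ℤ.+ (+ 2 ℤ.* ((N ℤ.+ s) ℤ.- (v ℤ.- k)) ℤ.- s) ≡
    (+ 2 ℤ.* k₀ ℤ.+ (+ 2 ℤ.* ((v ℤ.- k₀) ℤ.- (v ℤ.- k)) ℤ.+ s)) ℤ.+ + 2 ℤ.* N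
  y-exponent = ℤ-Solver.solve-∀
  z-exponent : ∀ v k₀ k N s f →
    (+ 1 ℤ.+ v) ℤ.+ ((k ℤ.- f) ℤ.+ ((N ℤ.+ s) ℤ.- (v ℤ.- k))) ≡
    (+ 2 ℤ.* k₀ ℤ.+ (+ 2 ℤ.* ((v ℤ.- k₀) ℤ.- (v ℤ.- k)) ℤ.+ s)) ℤ.+ (N ℤ.+ (+ 1 ℤ.- f))
  z-exponent = ℤ-Solver.solve-∀

2i+q≡i+[i+q] : ∀ i q → + 2 ℤ.* i ℤ.+ q ≡ i ℤ.+ (i ℤ.+ q)
2i+q≡i+[i+q] = ℤ-Solver.solve-∀

-- Integer powers of units in a commutative ring

module _ {c ℓ} (K : CommutativeRing c ℓ) where

  open CommutativeRing K renaming (refl to ≈-refl; sym to ≈-sym; trans to ≈-trans)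
  open Evaluation K
  open import Algebra.Properties.CommutativeSemiring.Exp commutativeSemiring
  open import Algebra.Properties.CommutativeSemigroup *-commutativeSemigroup
    using (interchange)
  open import Relation.Binary.Reasoning.Setoid setoid

  1^ : ∀ n → 1# ^ n ≈ 1#
  1^ zero    = ≈-refl
  1^ (suc n) = ≈-trans (*-identityˡ _) (1^ n)

  -- The mixed-sign case of the exponent law: each step of the recursion cancels one factor
  -- `u * u⁻¹`.
  ^ℤ-⊖ : ∀ ((u , u⁻¹ , i) : Unit) m n →
         (u , u⁻¹ , i) ^ℤ (m ℤ.⊖ n) ≈ u ^ m * u⁻¹ ^ n
  ^ℤ-⊖ U       m       zero    = ≈-sym (*-identityʳ _)
  ^ℤ-⊖ U       zero    (suc n) = ≈-sym (*-identityˡ _)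
  ^ℤ-⊖ U@(u , u⁻¹ , _ , uu⁻¹≈1) (suc m) (suc n) = begin
    U ^ℤ (suc m ℤ.⊖ suc n)         ≡⟨ cong (U ^ℤ_) (ℤ.[1+m]⊖[1+n]≡m⊖n m n) ⟩
    U ^ℤ (m ℤ.⊖ n)                 ≈⟨ ^ℤ-⊖ U m n ⟩
    u ^ m * u⁻¹ ^ n                ≈⟨ *-identityˡ _ ⟨
    1# * (u ^ m * u⁻¹ ^ n)         ≈⟨ *-congʳ uu⁻¹≈1 ⟨
    (u * u⁻¹) * (u ^ m * u⁻¹ ^ n)  ≈⟨ interchange _ _ _ _ ⟩
    u ^ suc m * u⁻¹ ^ suc n        ∎

  ^ℤ-homo : ∀ U i j → U ^ℤ (i ℤ.+ j) ≈ U ^ℤ i * U ^ℤ j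
  ^ℤ-homo (u , _)       (+ m)    (+ n)    = ^-homo-* u m n
  ^ℤ-homo U             (+ m)    -[1+ n ] = ^ℤ-⊖ U m (suc n)
  ^ℤ-homo U             -[1+ m ] (+ n)    = ≈-trans (^ℤ-⊖ U n (suc m)) (*-comm _ _)
  ^ℤ-homo (_ , u⁻¹ , _) -[1+ m ] -[1+ n ] = ≈-trans
    (^-congʳ u⁻¹ (cong suc (sym (ℕ.+-suc m n)))) (^-homo-* u⁻¹ (suc m) (suc n))

  infixl 7 _*ᵤ_
  _*ᵤ_ : Unit → Unit → Unit
  (u , u⁻¹ , u⁻¹u , uu⁻¹) *ᵤ (w , w⁻¹ , w⁻¹w , ww⁻¹) =
    u * w , u⁻¹ * w⁻¹ , ones u⁻¹u w⁻¹w , ones uu⁻¹ ww⁻¹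
    where
    ones : ∀ {a b a′ b′} → a * b ≈ 1# → a′ * b′ ≈ 1# → (a * a′) * (b * b′) ≈ 1#
    ones p q = ≈-trans (interchange _ _ _ _) (≈-trans (*-cong p q) (*-identityˡ 1#))

  ^ℤ-distrib-* : ∀ U W i → (U *ᵤ W) ^ℤ i ≈ U ^ℤ i * W ^ℤ i
  ^ℤ-distrib-* (u , _) (w , _) (+ m) = ^-distrib-* u w m
  ^ℤ-distrib-* (_ , u⁻¹ , _) (_ , w⁻¹ , _) -[1+ m ] = ^-distrib-* u⁻¹ w⁻¹ (suc m)

  ^ℤ-≈1 : ∀ U → ⟦ U ⟧ ≈ 1# → ∀ i → U ^ℤ i ≈ 1#
  ^ℤ-≈1 _ u≈1 (+ m) = ≈-trans (^-congˡ m u≈1) (1^ m)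
  ^ℤ-≈1 (u , u⁻¹ , u⁻¹u≈1 , _) u≈1 -[1+ m ] =
    ≈-trans (^-congˡ (suc m) u⁻¹≈1) (1^ (suc m))
    where
    u⁻¹≈1 : u⁻¹ ≈ 1#
    u⁻¹≈1 = ≈-trans (≈-sym (*-identityʳ _)) (≈-trans (*-congˡ (≈-sym u≈1)) u⁻¹u≈1)

  -- The common power `i` collects into a power of the unit `U *ᵤ V *ᵤ W`, which is 1. Taking `W` to
  -- be `Z` or `Z *ᵤ Z` serves the two surfaces.
  cancel-powers : ∀ U V W → ⟦ U ⟧ * ⟦ V ⟧ * ⟦ W ⟧ ≈ 1# → ∀ i p d →
                  U ^ℤ i * V ^ℤ (i ℤ.+ p) * (W ^ℤ i * d) ≈ V ^ℤ p * d
  cancel-powers U V W uvw≈1 i p d = begin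
    U ^ℤ i * V ^ℤ (i ℤ.+ p) * (W ^ℤ i * d)       ≈⟨ *-congʳ (*-congˡ (^ℤ-homo V i p)) ⟩
    U ^ℤ i * (V ^ℤ i * V ^ℤ p) * (W ^ℤ i * d)    ≈⟨ *-congʳ (*-assoc _ _ _) ⟨
    (U ^ℤ i * V ^ℤ i) * V ^ℤ p * (W ^ℤ i * d)    ≈⟨ interchange _ _ _ _ ⟩
    (U ^ℤ i * V ^ℤ i) * W ^ℤ i * (V ^ℤ p * d)    ≈⟨ *-congʳ (*-congʳ (^ℤ-distrib-* U V i)) ⟨
    (U *ᵤ V) ^ℤ i * W ^ℤ i * (V ^ℤ p * d)        ≈⟨ *-congʳ (^ℤ-distrib-* (U *ᵤ V) W i) ⟨
    (U *ᵤ V *ᵤ W) ^ℤ i * (V ^ℤ p * d)            ≈⟨ *-congʳ (^ℤ-≈1 (U *ᵤ V *ᵤ W) uvw≈1 i) ⟩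
    1# * (V ^ℤ p * d)                            ≈⟨ *-identityˡ _ ⟩
    V ^ℤ p * d                                   ∎

  -- Sums over spanning subgraphs

  sum : List Carrier → Carrier
  sum = foldr _+_ 0#

  sum-↭ : ∀ {xs ys} → xs ↭ ys → sum xs ≈ sum ys
  sum-↭ xs↭ys = Permutationₛ.foldr-commMonoid setoid +-isCommutativeMonoid
                  (↭⇒↭ₛ′ isEquivalence xs↭ys)

  -- The map `d` is `id` or `doubleXY`: in the second case `P` has integer exponents, and only its
  -- doubled monomials are known to be the terms `t x`.
  eval-map : ∀ {A : Set} X Y Z (d : Monomial → Monomial) (t : A → Monomial)
             (h : A → Carrier) →
             (∀ m x → d m ≡ t x → evalMonomial m X Y Z ≈ h x) →
             ∀ P xs → map d P ≡ map t xs → eval P X Y Z ≈ sum (map h xs)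
  eval-map X Y Z d t h eq []      []       _   = ≈-refl
  eval-map X Y Z d t h eq (m ∷ P) (x ∷ xs) dP≡ with dm≡ , dP≡′ ← ∷-injective dP≡ =
    +-cong (eq m x dm≡) (eval-map X Y Z d t h eq P xs dP≡′)

  -- Reindexing along the bijection `_Δ E′`, under which both arguments of `φ` are invariant.
  sum-dual : ∀ G (E′ : Subset (edges G)) (φ : ℕ → ℕ → Carrier) →
    let G′ = dual G E′ in
    sum (map (λ F → φ (N G F) (f G F)) (spanningSubgraphs G)) ≈
    sum (map (λ F → φ (N G′ F) (f G′ F)) (spanningSubgraphs G′))
  sum-dual G E′ φ = begin
    sum (map (λ F → φ (N G F) (f G F)) S)
      ≡⟨ cong sum (map-cong (λ F → cong₂ φ (N-dual G E′ F) (f-dual G E′ F)) S) ⟩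
    sum (map (ψ ∘ (_Δ E′)) S)    ≡⟨ cong sum (map-∘ S) ⟩
    sum (map ψ (map (_Δ E′) S))  ≈⟨ sum-↭ (map⁺ ψ (subsets-Δ E′)) ⟩
    sum (map ψ S)                ∎
    where
    S = spanningSubgraphs G
    ψ = λ F → φ (N (dual G E′) F) (f (dual G E′) F)

  -- Terms restricted to the two surfaces

  evalMonomial-√x√yz≈1 : ∀ X Y Z → ⟦ X ⟧ * ⟦ Y ⟧ * ⟦ Z ⟧ ≈ 1# → ∀ G m F →
    m ≡ normalizedTerm G F →
    evalMonomial m X Y Z ≈ Y ^ℤ (+ 2 ℤ.* + N G F) * Z ^ℤ zExponent (N G F) (f G F)
  evalMonomial-√x√yz≈1 X Y Z xyz≈1 G (a , b , l) F m≡
    with refl , refl ← normalizedTerm-exponents G F m≡ = begin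
    X ^ℤ a * Y ^ℤ (a ℤ.+ p) * Z ^ℤ (a ℤ.+ q)      ≈⟨ *-congˡ (^ℤ-homo Z a q) ⟩
    X ^ℤ a * Y ^ℤ (a ℤ.+ p) * (Z ^ℤ a * Z ^ℤ q)   ≈⟨ cancel-powers X Y Z xyz≈1 a p _ ⟩
    Y ^ℤ p * Z ^ℤ q                               ∎
    where
    p = + 2 ℤ.* + N G F
    q = zExponent (N G F) (f G F)

  evalMonomial-xyz²≈1 : ∀ X Y Z → ⟦ X ⟧ * ⟦ Y ⟧ * ⟦ Z ⟧ ^ 2 ≈ 1# → ∀ G m F →
    doubleXY m ≡ normalizedTerm G F →
    evalMonomial m X Y Z ≈ Y ^ℤ (+ N G F) * Z ^ℤ zExponent (N G F) (f G F)
  evalMonomial-xyz²≈1 X Y Z xyz²≈1 G (i , j , l) F m≡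
    with 2j≡ , l≡ ← normalizedTerm-exponents G F m≡
    -- The doubled exponents satisfy `2j = 2i + 2N`; halving gives `j = i + N`.
    with refl ← ℤ.*-cancelˡ-≡ (+ 2) j (i ℤ.+ + N G F)
                  (trans 2j≡ (sym (ℤ.*-distribˡ-+ (+ 2) i (+ N G F))))
    -- The exponent of `z` is not doubled, so it contains `2i`; this is split into one `i` for each
    -- factor of `z²`.
    with refl ← trans l≡ (2i+q≡i+[i+q] i (zExponent (N G F) (f G F))) = begin
    X ^ℤ i * Y ^ℤ (i ℤ.+ p) * Z ^ℤ (i ℤ.+ (i ℤ.+ q))
      ≈⟨ *-congˡ (≈-trans (^ℤ-homo Z i _) (*-congˡ (^ℤ-homo Z i q))) ⟩
    X ^ℤ i * Y ^ℤ (i ℤ.+ p) * (Z ^ℤ i * (Z ^ℤ i * Z ^ℤ q))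
      ≈⟨ *-congˡ (≈-trans (*-congʳ (^ℤ-distrib-* Z Z i)) (*-assoc _ _ _)) ⟨
    X ^ℤ i * Y ^ℤ (i ℤ.+ p) * ((Z *ᵤ Z) ^ℤ i * Z ^ℤ q)
      ≈⟨ cancel-powers X Y (Z *ᵤ Z) xyzz≈1 i p _ ⟩
    Y ^ℤ p * Z ^ℤ q ∎
    where
    p = + N G F
    q = zExponent (N G F) (f G F)
    xyzz≈1 : ⟦ X ⟧ * ⟦ Y ⟧ * (⟦ Z ⟧ * ⟦ Z ⟧) ≈ 1#
    xyzz≈1 = ≈-trans (*-congˡ (*-congˡ (≈-sym (*-identityʳ _)))) xyz²≈1

  -- The evaluation hypothesis ranges over all graphs, so one `φ` computes the terms of both `G` and
  -- its dual.
  eval-dual : ∀ X Y Z (d : Monomial → Monomial) (φ : ℕ → ℕ → Carrier) →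
    (∀ G m F → d m ≡ normalizedTerm G F →
      evalMonomial m X Y Z ≈ φ (N G F) (f G F)) →
    ∀ G (E′ : Subset (edges G)) P P′ →
    map d P ≡ normalizedR G → map d P′ ≡ normalizedR (dual G E′) →
    eval P X Y Z ≈ eval P′ X Y Z
  eval-dual X Y Z d φ eq G E′ P P′ dP≡ dP′≡ = ≈-trans (evaluate G P dP≡)
    (≈-trans (sum-dual G E′ φ) (≈-sym (evaluate (dual G E′) P′ dP′≡)))
    where
    evaluate : ∀ H Q → map d Q ≡ normalizedR H →
      eval Q X Y Z ≈ sum (map (λ F → φ (N H F) (f H F)) (spanningSubgraphs H))
    evaluate H Q dQ≡ = eval-map X Y Z d (normalizedTerm H) _ (eq H) Q _
      (trans dQ≡ (normalizedR-map H))

theorem3p1 : ∀ {c ℓ} (K : CommutativeRing c ℓ) (let open Evaluation K)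
    (G : SignedRibbonGraph) (E′ : Subset (edges G)) →
    let G′ = dual G E′ in
    EqualOn-√x√yz≈1 (normalizedR G) (normalizedR G′)
    × (∀ (P P′ : Laurent) → normalizedR G ≡ inRoots P → normalizedR G′ ≡ inRoots P′ →
       EqualOn-xyz²≈1 P P′)
theorem3p1 K G E′ =
  (λ √x √y z √x√yz≈1 →
    eval-dual K √x √y z id (λ N f → √y ^ℤ (+ 2 ℤ.* + N) * z ^ℤ zExponent N f)
      (evalMonomial-√x√yz≈1 K √x √y z √x√yz≈1) G E′ (normalizedR G) (normalizedR (dual G E′))
      (map-id _) (map-id _)) ,
  (λ P P′ ≡P ≡P′ x y z xyz²≈1 →
    -- Here `y` is the full variable rather than its square root, so its exponent is `N` in place of
    -- `2N`.
    eval-dual K x y z doubleXY (λ N f → y ^ℤ (+ N) * z ^ℤ zExponent N f)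
      (evalMonomial-xyz²≈1 K x y z xyz²≈1) G E′ P P′ (sym ≡P) (sym ≡P′))
  where
  open CommutativeRing K using (_*_)
  open Evaluation K using (_^ℤ_)
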